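{- There is a comonad in Kleisli form $(\mathbb{H}, \varepsilon, (\cdot)^*)$ on the category $\mathsf{HGraph}$ of hypergraphs. The counit is defined on representatives by $\varepsilon([p,a]) = a$. Coextension of a hypergraph morphism $h:\mathbb{H}\mathcal{H}_1\to\mathcal{H}_2$ is defined on representatives by \[ h^*([[U_1,\ldots,U_n], a]) = [[V_1,\ldots,V_n], h([[U_1,\ldots,U_n], a])] \] where $V_j = \{ h([[U_1,\ldots,U_j], b]) \mid b \in U_j \}$ for $1 \leq j \leq n$.
   Context: A hypergraph $(V,E)$ consists of a set $V$ of vertices and a family $E$ of finite subsets of $V$ (hyperedges); a morphism is a function on vertices mapping hyperedges to hyperedges. For a hypergraph, a focussed play is $\langle p,a\rangle$ with $p=[U_1,\ldots,U_n]$ a non-empty list of hyperedges and $a\in U_n$. Define $\langle p,a\rangle\sim\langle q,a'\rangle$ iff $a=a'$, the greatest common prefix $p\sqcap q$ is non-empty, and $a$ belongs to the last hyperedge of every play on the prefix-order paths from $p\sqcap q$ to $p$ and to $q$; $[p,a]$ denotes the equivalence class. $\mathbb{H}(V,E)$ has vertices the classes $[p,a]$ and hyperedges the sets $\{[p,a]\mid a\in U\}$ for a play $p$ with last element $U \in E$. -}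

module Defs where

open import Axiom.ExcludedMiddle using (ExcludedMiddle)
open import Data.List.Base using (List; map)
open import Data.List.Relation.Unary.Any using (Any; here; there)
import Data.List.Membership.Setoid as Membership
import Data.List.Membership.Setoid.Properties as Membershipₚ
import Data.List.Relation.Binary.Subset.Setoid as Subset
open import Data.Nat.Base using (ℕ; suc; _≤_)
import Data.Nat.Properties as ℕ
open import Data.Product.Base using (_×_; _,_; proj₁; proj₂; ∃; ∃-syntax)
open import Data.Sum.Base using (_⊎_; inj₁; inj₂; [_,_]′)
open import Function.Base using (id; _∘_)
open import Function.Bundles using (Func)
import Function.Construct.Composition as Compose
import Function.Construct.Identity as Identity
open import Level using (Level; _⊔_) renaming (suc to lsuc)
open import Relation.Binary.Bundles using (Setoid)
open import Relation.Binary.Core using (Rel)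
open import Relation.Binary.Definitions using (_Respects_; Symmetric; Transitive)
open import Relation.Binary.Structures using (IsEquivalence)
import Relation.Binary.Construct.Closure.Equivalence as EqC
open import Relation.Binary.Construct.Closure.ReflexiveTransitive using (_◅_; ε)
open import Relation.Binary.Construct.Closure.Symmetric using (fwd)
open import Relation.Binary.PropositionalEquality.Core as ≡ using (_≡_)
open import Relation.Nullary using (yes; no; contradiction)
open import Relation.Unary using (Pred)

-- Sets are setoids. A finite subset of a setoid S is represented by a list
-- enumerating its elements; two lists denote the same finite subset when they
-- are related by _≐_, and  map f xs  denotes the direct image of xs under f.

module FiniteSubset {c ℓ} (S : Setoid c ℓ) where
  open Setoid S using (Carrier)
  open Subset S using (_⊆_)

  infix 4 _≐_

  _≐_ : Rel (List Carrier) (c ⊔ ℓ)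
  xs ≐ ys = xs ⊆ ys × ys ⊆ xs

  ≐-refl : ∀ {xs} → xs ≐ xs
  ≐-refl = id , id

  ≐-sym : ∀ {xs ys} → xs ≐ ys → ys ≐ xs
  ≐-sym (f , g) = g , f

  ≐-trans : ∀ {xs ys zs} → xs ≐ ys → ys ≐ zs → xs ≐ zs
  ≐-trans (f , g) (f′ , g′) = (λ i → f′ (f i)) , (λ i → g (g′ i))

-- The family of hyperedges is a predicate on finite subsets, hence required to
-- be independent of the enumeration.

record Hypergraph (ℓ : Level) : Set (lsuc ℓ) where
  field
    V : Setoid ℓ ℓ
  open Setoid V public using (_≈_) renaming (Carrier to Vertex)
  open FiniteSubset V public using (_≐_)
  open Membership V public using (_∈_)
  field
    E      : Pred (List Vertex) ℓ
    E-resp : E Respects _≐_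

  Hyperedge : Set ℓ
  Hyperedge = ∃ E

private variable
  ℓ : Level

record Morphism (𝓗₁ 𝓗₂ : Hypergraph ℓ) : Set ℓ where
  private
    module 𝓗₁ = Hypergraph 𝓗₁
    module 𝓗₂ = Hypergraph 𝓗₂
  field
    func   : Func 𝓗₁.V 𝓗₂.V
  open Func func public
  field
    to-E : ∀ {U} → 𝓗₁.E U → 𝓗₂.E (map to U)

infix 4 _≈ᴹ_

_≈ᴹ_ : {𝓗₁ 𝓗₂ : Hypergraph ℓ} → Rel (Morphism 𝓗₁ 𝓗₂) ℓ
_≈ᴹ_ {𝓗₂ = 𝓗₂} f g = ∀ x → Morphism.to f x ≈ Morphism.to g x
  where open Hypergraph 𝓗₂

idᴹ : {𝓗 : Hypergraph ℓ} → Morphism 𝓗 𝓗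
idᴹ {𝓗 = 𝓗} = record
  { func = Identity.function V
  ; to-E = E-resp (map-id-⊇ , map-id-⊆)
  }
  where
  open Hypergraph 𝓗
  open Setoid V using (sym)
  open Membershipₚ using (∈-map⁺; ∈-map⁻; ∈-resp-≈)

  map-id-⊇ : ∀ {xs x} → x ∈ xs → x ∈ map id xs
  map-id-⊇ = ∈-map⁺ V V id

  map-id-⊆ : ∀ {xs x} → x ∈ map id xs → x ∈ xs
  map-id-⊆ x∈ with ∈-map⁻ V V x∈
  ... | _ , y∈xs , x≈y = ∈-resp-≈ V (sym x≈y) y∈xs

infixr 9 _∘ᴹ_

_∘ᴹ_ : {𝓗₁ 𝓗₂ 𝓗₃ : Hypergraph ℓ} → Morphism 𝓗₂ 𝓗₃ → Morphism 𝓗₁ 𝓗₂ → Morphism 𝓗₁ 𝓗₃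
_∘ᴹ_ {𝓗₁ = 𝓗₁} {𝓗₂} {𝓗₃} g f = record
  { func = Compose.function f.func g.func
  ; to-E = λ e → 𝓗₃.E-resp (split , merge) (g.to-E (f.to-E e))
  }
  where
  module f = Morphism f
  module g = Morphism g
  module 𝓗₁ = Hypergraph 𝓗₁
  module 𝓗₂ = Hypergraph 𝓗₂
  module 𝓗₃ = Hypergraph 𝓗₃
  open Setoid 𝓗₃.V using (trans; sym)
  open Membershipₚ using (∈-map⁺; ∈-map⁻; ∈-resp-≈)

  split : ∀ {xs x} → x 𝓗₃.∈ map g.to (map f.to xs) → x 𝓗₃.∈ map (λ y → g.to (f.to y)) xs
  split x∈ with ∈-map⁻ 𝓗₂.V 𝓗₃.V x∈
  ... | _ , y∈ , x≈gy with ∈-map⁻ 𝓗₁.V 𝓗₂.V y∈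
  ... | _ , z∈ , y≈fz = ∈-resp-≈ 𝓗₃.V (sym (trans x≈gy (g.cong y≈fz)))
                          (∈-map⁺ 𝓗₁.V 𝓗₃.V (λ e → g.cong (f.cong e)) z∈)

  merge : ∀ {xs x} → x 𝓗₃.∈ map (λ y → g.to (f.to y)) xs → x 𝓗₃.∈ map g.to (map f.to xs)
  merge x∈ with ∈-map⁻ 𝓗₁.V 𝓗₃.V x∈
  ... | _ , z∈ , x≈gfz = ∈-resp-≈ 𝓗₃.V (sym x≈gfz)
                           (∈-map⁺ 𝓗₂.V 𝓗₃.V g.cong (∈-map⁺ 𝓗₁.V 𝓗₂.V f.cong z∈))

record Category o m e : Set (lsuc (o ⊔ m ⊔ e)) where
  infix  4 _≈_
  infixr 9 _∘ᶜ_
  field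
    Obj  : Set o
    Hom  : Obj → Obj → Set m
    _≈_  : ∀ {A B} → Rel (Hom A B) e
    idᶜ  : ∀ {A} → Hom A A
    _∘ᶜ_ : ∀ {A B C} → Hom B C → Hom A B → Hom A C
    ≈-isEquivalence : ∀ {A B} → IsEquivalence (_≈_ {A} {B})
    ∘-cong    : ∀ {A B C} {f f′ : Hom B C} {g g′ : Hom A B} →
                f ≈ f′ → g ≈ g′ → f ∘ᶜ g ≈ f′ ∘ᶜ g′
    identityˡ : ∀ {A B} (f : Hom A B) → idᶜ ∘ᶜ f ≈ f
    identityʳ : ∀ {A B} (f : Hom A B) → f ∘ᶜ idᶜ ≈ f
    assoc     : ∀ {A B C D} (f : Hom C D) (g : Hom B C) (h : Hom A B) →
                (f ∘ᶜ g) ∘ᶜ h ≈ f ∘ᶜ (g ∘ᶜ h)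

HGraph : (ℓ : Level) → Category (lsuc ℓ) ℓ ℓ
HGraph ℓ = record
  { Obj  = Hypergraph ℓ
  ; Hom  = Morphism
  ; _≈_  = _≈ᴹ_
  ; idᶜ  = idᴹ
  ; _∘ᶜ_ = _∘ᴹ_
  ; ≈-isEquivalence = λ {_} {B} → record
      { refl  = λ _ → refl B
      ; sym   = λ f≈g x → sym B (f≈g x)
      ; trans = λ f≈g g≈h x → trans B (f≈g x) (g≈h x)
      }
  ; ∘-cong    = λ {_} {_} {C} {f} {f′} {g} {g′} f≈f′ g≈g′ x →
                  trans C (Morphism.cong f (g≈g′ x)) (f≈f′ (Morphism.to g′ x))
  ; identityˡ = λ {_} {B} _ _ → refl B
  ; identityʳ = λ {_} {B} _ _ → refl B
  ; assoc     = λ {_} {_} {_} {D} _ _ _ _ → refl D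
  }
  where
  module _ (𝓗 : Hypergraph ℓ) where
    open Setoid (Hypergraph.V 𝓗) public using (refl; sym; trans)

-- A comonad in Kleisli form with object map H. Hom-sets being setoids,
-- coextension has to respect equality of morphisms.

record KleisliComonad {o m e} (C : Category o m e) (H : Category.Obj C → Category.Obj C)
  : Set (o ⊔ m ⊔ e) where
  open Category C
  infix 10 _*
  field
    counit : ∀ A → Hom (H A) A
    _*     : ∀ {A B} → Hom (H A) B → Hom (H A) (H B)
    *-cong       : ∀ {A B} {h k : Hom (H A) B} → h ≈ k → h * ≈ k *
    counit-*     : ∀ {A} → counit A * ≈ idᶜ
    counit-∘-*   : ∀ {A B} (h : Hom (H A) B) → counit B ∘ᶜ h * ≈ h
    *-∘-*        : ∀ {A B D} (h : Hom (H A) B) (k : Hom (H B) D) →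
                   (k ∘ᶜ h *) * ≈ k * ∘ᶜ h *

module Plays (𝓗 : Hypergraph ℓ) where
  open Hypergraph 𝓗
  open FiniteSubset V using (≐-refl; ≐-sym; ≐-trans)
  private module V = Setoid V

  infixl 5 _▷_
  infix  4 _≋_ _⊑_ _∼_

  -- Non-empty lists of hyperedges; p ▷ U extends p by U at the end.
  data Play : Set ℓ where
    [_] : Hyperedge → Play
    _▷_ : Play → Hyperedge → Play

  lastEdge : Play → Hyperedge
  lastEdge [ U ]   = U
  lastEdge (_ ▷ U) = U

  last : Play → List Vertex
  last p = proj₁ (lastEdge p)

  -- Equality of plays: same length and entrywise the same finite subsets.
  data _≋_ : Rel Play ℓ where
    [_] : ∀ {U U′} → proj₁ U ≐ proj₁ U′ → [ U ] ≋ [ U′ ]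
    _▷_ : ∀ {p p′ U U′} → p ≋ p′ → proj₁ U ≐ proj₁ U′ → p ▷ U ≋ p′ ▷ U′

  -- The prefix order.
  data _⊑_ : Rel Play ℓ where
    whole : ∀ {p q} → p ≋ q → p ⊑ q
    snoc  : ∀ {p q U} → p ⊑ q → p ⊑ q ▷ U

  -- r is the greatest common prefix p ⊓ q. As a Play is never empty, the
  -- existence of such an r says precisely that p ⊓ q is non-empty.
  record IsGreatestCommonPrefix (r p q : Play) : Set ℓ where
    field
      lowerˡ   : r ⊑ p
      lowerʳ   : r ⊑ q
      greatest : ∀ s → s ⊑ p → s ⊑ q → s ⊑ r

  ActiveOnPath : Vertex → (r p : Play) → Set ℓ
  ActiveOnPath a r p = ∀ s → r ⊑ s → s ⊑ p → a ∈ last s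

  record FocussedPlay : Set ℓ where
    constructor ⟨_,_,_⟩
    field
      play   : Play
      focus  : Vertex
      focus∈ : focus ∈ last play
  open FocussedPlay public

  record _∼_ (x y : FocussedPlay) : Set ℓ where
    field
      focus-≈ : focus x ≈ focus y
      meet    : Play
      isMeet  : IsGreatestCommonPrefix meet (play x) (play y)
      activeˡ : ActiveOnPath (focus x) meet (play x)
      activeʳ : ActiveOnPath (focus x) meet (play y)

  -- The set of classes [p,a]: equality is the equivalence relation generated
  -- by _∼_. Classically _∼_ already is an equivalence relation, so that this
  -- is _∼_ itself (see ≈⇒∼ below). Constructively transitivity of _∼_ would
  -- require greatest common prefixes to exist, i.e. decidable equality of
  -- hyperedges, which is not assumed.
  classes : Setoid ℓ ℓ
  classes = EqC.setoid _∼_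

  -- The finite set { [p,a] ∣ a ∈ U } with U the last hyperedge of p.
  fan : Play → List FocussedPlay
  fan p = Membership.mapWith∈ V (last p) (λ {a} a∈U → ⟨ p , a , a∈U ⟩)

  ≋-refl : ∀ {p} → p ≋ p
  ≋-refl {[ _ ]} = [ ≐-refl ]
  ≋-refl {_ ▷ _} = ≋-refl ▷ ≐-refl

  ≋-sym : ∀ {p q} → p ≋ q → q ≋ p
  ≋-sym [ e ]   = [ ≐-sym e ]
  ≋-sym (d ▷ e) = ≋-sym d ▷ ≐-sym e

  ≋-trans : ∀ {p q r} → p ≋ q → q ≋ r → p ≋ r
  ≋-trans [ e ]   [ e′ ]    = [ ≐-trans e e′ ]
  ≋-trans (d ▷ e) (d′ ▷ e′) = ≋-trans d d′ ▷ ≐-trans e e′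

  last-cong : ∀ {p q} → p ≋ q → last p ≐ last q
  last-cong [ e ]   = e
  last-cong (_ ▷ e) = e

  ⊑-respʳ-≋ : ∀ {p q q′} → q ≋ q′ → p ⊑ q → p ⊑ q′
  ⊑-respʳ-≋ e       (whole d) = whole (≋-trans d e)
  ⊑-respʳ-≋ (e ▷ _) (snoc s)  = snoc (⊑-respʳ-≋ e s)

  ⊑-refl : ∀ {p} → p ⊑ p
  ⊑-refl = whole ≋-refl

  ⊑-trans : ∀ {p q r} → p ⊑ q → q ⊑ r → p ⊑ r
  ⊑-trans s (whole e) = ⊑-respʳ-≋ e s
  ⊑-trans s (snoc t)  = snoc (⊑-trans s t)

  length : Play → ℕ
  length [ _ ]   = 1
  length (p ▷ _) = suc (length p)

  length-cong : ∀ {p q} → p ≋ q → length p ≡ length q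
  length-cong [ _ ]   = ≡.refl
  length-cong (e ▷ _) = ≡.cong suc (length-cong e)

  length-mono : ∀ {p q} → p ⊑ q → length p ≤ length q
  length-mono (whole e) = ℕ.≤-reflexive (length-cong e)
  length-mono (snoc s)  = ℕ.m≤n⇒m≤1+n (length-mono s)

  ⊑-antisym : ∀ {p q} → p ⊑ q → q ⊑ p → p ≋ q
  ⊑-antisym (whole e) _ = e
  ⊑-antisym (snoc s)  t = contradiction (length-mono (⊑-trans t s)) ℕ.1+n≰n

  ⊑-linear : ∀ {p q r} → p ⊑ r → q ⊑ r → p ⊑ q ⊎ q ⊑ p
  ⊑-linear (whole e) t         = inj₂ (⊑-respʳ-≋ (≋-sym e) t)
  ⊑-linear (snoc s)  (whole e) = inj₁ (⊑-respʳ-≋ (≋-sym e) (snoc s))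
  ⊑-linear (snoc s)  (snoc t)  = ⊑-linear s t

  ∼-reflexive : ∀ {x y} → play x ≋ play y → focus x ≈ focus y → x ∼ y
  ∼-reflexive {x} {y} e a≈b = record
    { focus-≈ = a≈b
    ; meet    = play x
    ; isMeet  = record
        { lowerˡ = ⊑-refl ; lowerʳ = whole e ; greatest = λ _ s⊑p _ → s⊑p }
    ; activeˡ = λ s p⊑s s⊑p → proj₁ (last-cong (⊑-antisym p⊑s s⊑p)) (focus∈ x)
    ; activeʳ = λ s p⊑s s⊑q → proj₁ (last-cong
                  (⊑-antisym p⊑s (⊑-respʳ-≋ (≋-sym e) s⊑q))) (focus∈ x)
    }

  ∼-sym : Symmetric _∼_
  ∼-sym x∼y = record
    { focus-≈ = V.sym focus-≈
    ; meet    = meet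
    ; isMeet  = record { lowerˡ = lowerʳ ; lowerʳ = lowerˡ ; greatest = λ s p q → greatest s q p }
    ; activeˡ = λ s l u → Membershipₚ.∈-resp-≈ V focus-≈ (activeʳ s l u)
    ; activeʳ = λ s l u → Membershipₚ.∈-resp-≈ V focus-≈ (activeˡ s l u)
    }
    where
    open _∼_ x∼y
    open IsGreatestCommonPrefix isMeet

  module _ (em : ExcludedMiddle ℓ) where

    greatestCommonPrefix : ∀ {t} p q → t ⊑ p → t ⊑ q →
                           ∃[ r ] IsGreatestCommonPrefix r p q
    greatestCommonPrefix p q t⊑p t⊑q with em {p ⊑ q}
    greatestCommonPrefix p q t⊑p t⊑q | yes p⊑q = p , record
      { lowerˡ = ⊑-refl ; lowerʳ = p⊑q ; greatest = λ _ s⊑p _ → s⊑p }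
    greatestCommonPrefix p q (whole t≋p) t⊑q | no p⋢q =
      contradiction (⊑-trans (whole (≋-sym t≋p)) t⊑q) p⋢q
    greatestCommonPrefix (p ▷ U) q (snoc t⊑p) t⊑q | no p⋢q =
      let r , isMeet = greatestCommonPrefix p q t⊑p t⊑q
          open IsGreatestCommonPrefix isMeet
      in r , record
        { lowerˡ   = snoc lowerˡ
        ; lowerʳ   = lowerʳ
        ; greatest = λ where
            s (whole s≋p) s⊑q → contradiction (⊑-trans (whole (≋-sym s≋p)) s⊑q) p⋢q
            s (snoc s⊑p)  s⊑q → greatest s s⊑p s⊑q
        }

    ∼-fromCommonPrefix : ∀ {x y} t → focus x ≈ focus y → t ⊑ play x → t ⊑ play y →
      ActiveOnPath (focus x) t (play x) → ActiveOnPath (focus x) t (play y) → x ∼ y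
    ∼-fromCommonPrefix {x} {y} t a≈b t⊑p t⊑q activeˡ activeʳ =
      let r , isMeet = greatestCommonPrefix (play x) (play y) t⊑p t⊑q
          t⊑r = IsGreatestCommonPrefix.greatest isMeet t t⊑p t⊑q
      in record
        { focus-≈ = a≈b
        ; meet    = r
        ; isMeet  = isMeet
        ; activeˡ = λ s r⊑s → activeˡ s (⊑-trans t⊑r r⊑s)
        ; activeʳ = λ s r⊑s → activeʳ s (⊑-trans t⊑r r⊑s)
        }

    ∼-trans : Transitive _∼_
    ∼-trans {x} {y} {z} x∼y y∼z with ⊑-linear u.lowerʳ v.lowerˡ
      where
      module u = IsGreatestCommonPrefix (_∼_.isMeet x∼y)
      module v = IsGreatestCommonPrefix (_∼_.isMeet y∼z)
    ... | inj₁ u⊑v = ∼-fromCommonPrefix x∼y.meet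
            (V.trans x∼y.focus-≈ y∼z.focus-≈) u.lowerˡ (⊑-trans u⊑v v.lowerʳ) x∼y.activeˡ
            (λ s u⊑s s⊑r → [ (λ s⊑v → x∼y.activeʳ s u⊑s (⊑-trans s⊑v v.lowerˡ))
                           , (λ v⊑s → ∈-resp-≈ V (V.sym x∼y.focus-≈) (y∼z.activeʳ s v⊑s s⊑r))
                           ]′ (⊑-linear s⊑r v.lowerʳ))
      where
      open Membershipₚ using (∈-resp-≈)
      module x∼y = _∼_ x∼y
      module y∼z = _∼_ y∼z
      module u = IsGreatestCommonPrefix x∼y.isMeet
      module v = IsGreatestCommonPrefix y∼z.isMeet
    ... | inj₂ v⊑u = ∼-fromCommonPrefix y∼z.meet
            (V.trans x∼y.focus-≈ y∼z.focus-≈) (⊑-trans v⊑u u.lowerˡ) v.lowerʳ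
            (λ s v⊑s s⊑p → [ (λ s⊑u → ∈-resp-≈ V (V.sym x∼y.focus-≈)
                                        (y∼z.activeˡ s v⊑s (⊑-trans s⊑u u.lowerʳ)))
                           , (λ u⊑s → x∼y.activeˡ s u⊑s s⊑p)
                           ]′ (⊑-linear s⊑p u.lowerˡ))
            (λ s v⊑s s⊑r → ∈-resp-≈ V (V.sym x∼y.focus-≈) (y∼z.activeʳ s v⊑s s⊑r))
      where
      open Membershipₚ using (∈-resp-≈)
      module x∼y = _∼_ x∼y
      module y∼z = _∼_ y∼z
      module u = IsGreatestCommonPrefix x∼y.isMeet
      module v = IsGreatestCommonPrefix y∼z.isMeet

    ∼-isEquivalence : IsEquivalence _∼_
    ∼-isEquivalence = record
      { refl = ∼-reflexive ≋-refl V.refl ; sym = ∼-sym ; trans = ∼-trans }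

    ≈⇒∼ : ∀ {x y} → Setoid._≈_ classes x y → x ∼ y
    ≈⇒∼ = EqC.fold ∼-isEquivalence id

ℍ : Hypergraph ℓ → Hypergraph ℓ
ℍ 𝓗 = record
  { V      = classes
  ; E      = λ xs → ∃[ p ] xs ≐ fan p
  ; E-resp = λ xs≐ys (p , xs≐fan) → p , ≐-trans (≐-sym xs≐ys) xs≐fan
  }
  where
  open Plays 𝓗
  open FiniteSubset classes

∈-mapWith∈ : ∀ {a b s r} (S : Setoid a s) {B : Set b} (R : Rel B r) {xs : List (Setoid.Carrier S)}
  (f : ∀ {x} → Membership._∈_ S x xs → B) →
  (∀ {x y} (x∈xs : Membership._∈_ S x xs) (y∈xs : Membership._∈_ S y xs) →
    Setoid._≈_ S x y → R (f x∈xs) (f y∈xs)) →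
  ∀ {x} (x∈xs : Membership._∈_ S x xs) → Any (R (f x∈xs)) (Membership.mapWith∈ S xs f)
∈-mapWith∈ S R f f-cong (here x≈y)   = here (f-cong (here x≈y) (here (Setoid.refl S)) x≈y)
∈-mapWith∈ S R f f-cong (there x∈xs) =
  there (∈-mapWith∈ S R (λ i → f (there i)) (λ i j → f-cong (there i) (there j)) x∈xs)

module _ (𝓗 : Hypergraph ℓ) where
  open Hypergraph 𝓗
  open Plays 𝓗

  ∈-fan : ∀ p {a} (a∈U : a ∈ last p) → Hypergraph._∈_ (ℍ 𝓗) ⟨ p , a , a∈U ⟩ (fan p)
  ∈-fan p = ∈-mapWith∈ V (Setoid._≈_ classes) (λ {a} a∈U → ⟨ p , a , a∈U ⟩)
              (λ _ _ a≈b → fwd (∼-reflexive ≋-refl a≈b) ◅ ε)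

module Coextension {𝓗₁ 𝓗₂ : Hypergraph ℓ} (h : Morphism (ℍ 𝓗₁) 𝓗₂) where
  private
    module 𝓗₁ = Hypergraph 𝓗₁
    module 𝓗₂ = Hypergraph 𝓗₂
    module ℍ𝓗₁ = Hypergraph (ℍ 𝓗₁)
    module h = Morphism h
    module P₁ = Plays 𝓗₁
    module P₂ = Plays 𝓗₂
  open P₁ using ([_]; _▷_)

  -- For p = [U₁,…,Uⱼ] this is Vⱼ = { h([p,b]) ∣ b ∈ Uⱼ }.
  imageEdge : P₁.Play → 𝓗₂.Hyperedge
  imageEdge p = map h.to (P₁.fan p) , h.to-E (p , FiniteSubset.≐-refl ℍ𝓗₁.V)

  -- [U₁,…,Uₙ] ↦ [V₁,…,Vₙ]
  imagePlay : P₁.Play → P₂.Play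
  imagePlay [ U ]   = P₂.[ imageEdge [ U ] ]
  imagePlay (p ▷ U) = imagePlay p P₂.▷ imageEdge (p ▷ U)

  last-imagePlay : ∀ p → P₂.lastEdge (imagePlay p) ≡ imageEdge p
  last-imagePlay [ _ ]   = ≡.refl
  last-imagePlay (_ ▷ _) = ≡.refl

  image∈ : ∀ p {a} (a∈U : a 𝓗₁.∈ P₁.last p) →
           h.to P₁.⟨ p , a , a∈U ⟩ 𝓗₂.∈ P₂.last (imagePlay p)
  image∈ p {a} a∈U =
    ≡.subst (λ U → h.to P₁.⟨ p , a , a∈U ⟩ 𝓗₂.∈ proj₁ U) (≡.sym (last-imagePlay p))
      (Membershipₚ.∈-map⁺ ℍ𝓗₁.V 𝓗₂.V h.cong (∈-fan 𝓗₁ p a∈U))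

{-# OPTIONS --safe #-}
module Submission where

open import Defs
open import Data.List.Base using (List; _∷_; map)
open import Data.List.Properties using (map-∘)
import Data.List.Membership.Setoid as Membership
import Data.List.Membership.Setoid.Properties as Membershipₚ
import Data.List.Relation.Binary.Subset.Setoid.Properties as Subsetₚ
import Data.List.Relation.Unary.Any as Any
import Data.List.Relation.Unary.Any.Properties as Anyₚ
open import Data.Product using (Σ-syntax; _×_; _,_; proj₁; proj₂; ∃₂)
open import Function.Base using (_∘_)
open import Level using (Level)
open import Relation.Binary.Bundles using (Setoid)
open import Relation.Binary.Core using (Rel; _⇒_; _Preserves_⟶_)
open import Relation.Binary.Structures using (IsEquivalence)
import Relation.Binary.Construct.Closure.Equivalence as EqC
import Relation.Binary.Construct.On as On
open import Relation.Binary.PropositionalEquality.Core using (subst; sym)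
open import Relation.Unary using (Pred)

-- If r is the meet of p and q and a is active on both paths, then (p,a) and
-- (q,a) are both joined to (r,a) by one-step extensions along which a stays
-- active. Hence a map on focussed plays descends to classes as soon as it
-- respects one-step extensions and entrywise equality of plays. For coextension
-- this is immediate because h is itself defined on classes, and no greatest
-- common prefix ever has to be computed in the image. The comonad laws then
-- reduce to the fact that coextension maps the fan of p onto the fan of
-- [V₁,…,Vₙ].

private variable
  ℓ : Level

module _ {a b r} (S : Setoid a r) {B : Set b} where
  open Membership S using (_∈_; mapWith∈)
  open Setoid S using (Carrier; refl)

  -- The inversion principle behind membership in a `fan`; the witness comes with its membership
  -- proof because `f` depends on it.
  mapWith∈⁻ : ∀ {q} {Q : Pred B q} (xs : List Carrier) (f : ∀ {x} → x ∈ xs → B) →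
              Any.Any Q (mapWith∈ xs f) → ∃₂ λ x (x∈xs : x ∈ xs) → Q (f x∈xs)
  mapWith∈⁻ (x ∷ xs) f (Any.here q)  = x , Any.here refl , q
  mapWith∈⁻ (x ∷ xs) f (Any.there i) =
    let y , y∈xs , q = mapWith∈⁻ xs (λ j → f (Any.there j)) i in y , Any.there y∈xs , q

module _ {a c r} {A : Set a} (R : Setoid c r) where
  open FiniteSubset R
  open Setoid R using (Carrier; _≈_; trans) renaming (sym to ≈-sym)

  map-≗-≐ : {f g : A → Carrier} → (∀ x → f x ≈ g x) → ∀ xs → map f xs ≐ map g xs
  map-≗-≐ f≈g xs =
      (λ i → Anyₚ.map⁺ (Any.map (λ e → trans e (f≈g _)) (Anyₚ.map⁻ {xs = xs} i)))
    , (λ i → Anyₚ.map⁺ (Any.map (λ e → trans e (≈-sym (f≈g _))) (Anyₚ.map⁻ {xs = xs} i)))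

module _ {c₁ c₂ s r} (S : Setoid c₁ s) (R : Setoid c₂ r) where
  private
    module S = Setoid S
    module R = Setoid R
    module FS = FiniteSubset S
    module FR = FiniteSubset R

  map-cong-≐ : ∀ {f xs ys} → f Preserves S._≈_ ⟶ R._≈_ → xs FS.≐ ys → map f xs FR.≐ map f ys
  map-cong-≐ f-cong (xs⊆ys , ys⊆xs) =
    Subsetₚ.map⁺ S R f-cong xs⊆ys , Subsetₚ.map⁺ S R f-cong ys⊆xs

  map-∘-≐ : ∀ {a} {A : Set a} {f : A → S.Carrier} {g xs ys} → g Preserves S._≈_ ⟶ R._≈_ →
            map f xs FS.≐ ys → map (g ∘ f) xs FR.≐ map g ys
  map-∘-≐ {g = g} {xs} {ys} g-cong fxs≐ys =
    subst (FR._≐ map g ys) (sym (map-∘ xs)) (map-cong-≐ g-cong fxs≐ys)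

module _ (𝓗 : Hypergraph ℓ) where
  open Hypergraph 𝓗
  open Plays 𝓗
  private
    module V = Setoid V
    module C = Setoid classes
    module FC = FiniteSubset classes
  open Membershipₚ using (∈-resp-≈; ∈-map⁺; ∈-map⁻)

  ≋⇒≈ : ∀ {x y} → play x ≋ play y → focus x ≈ focus y → x C.≈ y
  ≋⇒≈ p≋q a≈b = EqC.return (∼-reflexive p≋q a≈b)

  -- Since `p` is a prefix of `p ▷ U`, it is itself the meet, and up to `_≋_` only `p` and `p ▷ U`
  -- lie on the paths.
  ▷-∼ : ∀ {p U a} (a∈p : a ∈ last p) (a∈U : a ∈ proj₁ U) → ⟨ p , a , a∈p ⟩ ∼ ⟨ p ▷ U , a , a∈U ⟩
  ▷-∼ {p} {U} {a} a∈p a∈U = record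
    { focus-≈ = V.refl
    ; meet    = p
    ; isMeet  = record { lowerˡ = ⊑-refl ; lowerʳ = snoc ⊑-refl ; greatest = λ _ s⊑p _ → s⊑p }
    ; activeˡ = at-p
    ; activeʳ = λ where
        s p⊑s (whole s≋pU) → proj₂ (last-cong s≋pU) a∈U
        s p⊑s (snoc s⊑p)   → at-p s p⊑s s⊑p
    }
    where
    at-p : ActiveOnPath a p p
    at-p s p⊑s s⊑p = proj₁ (last-cong (⊑-antisym p⊑s s⊑p)) a∈p

  module _ {r} {_R_ : Rel FocussedPlay r} (isEquivalence : IsEquivalence _R_)
    (≋⇒R : ∀ {x y} → play x ≋ play y → focus x ≈ focus y → x R y)
    (▷-R : ∀ {p U a} (a∈p : a ∈ last p) (a∈U : a ∈ proj₁ U) →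
           ⟨ p , a , a∈p ⟩ R ⟨ p ▷ U , a , a∈U ⟩)
    where
    private module R = IsEquivalence isEquivalence

    -- The path from `r` to `p` is climbed one hyperedge at a time, by induction on the prefix
    -- derivation.
    ⊑⇒R : ∀ {r p a} → r ⊑ p → ActiveOnPath a r p → (a∈r : a ∈ last r) (a∈p : a ∈ last p) →
          ⟨ r , a , a∈r ⟩ R ⟨ p , a , a∈p ⟩
    ⊑⇒R (whole r≋p) _      a∈r a∈p = ≋⇒R r≋p V.refl
    ⊑⇒R (snoc r⊑p)  active a∈r a∈U =
      -- The play one step shorter lies on the path, so activity lets it be focussed at `a`.
      let a∈p = active _ r⊑p (snoc ⊑-refl) in
      R.trans (⊑⇒R r⊑p (λ s r⊑s s⊑p → active s r⊑s (snoc s⊑p)) a∈r a∈p) (▷-R a∈p a∈U)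

    ≈-elim : C._≈_ ⇒ _R_
    ≈-elim = EqC.fold isEquivalence ∼⇒R
      where
      ∼⇒R : _∼_ ⇒ _R_
      ∼⇒R {x} {y} x∼y =
        R.trans (R.sym (⊑⇒R lowerˡ activeˡ a∈meet (focus∈ x)))
          -- Activity concerns `focus x`, so the path reaches `play y` focussed at `focus x`; only
          -- then is the focus exchanged for `focus y`.
          (R.trans (⊑⇒R lowerʳ activeʳ a∈meet (activeʳ (play y) lowerʳ ⊑-refl))
            (≋⇒R ≋-refl focus-≈))
        where
        open _∼_ x∼y
        open IsGreatestCommonPrefix isMeet
        a∈meet = activeˡ meet ⊑-refl lowerˡ

  focus-cong : focus Preserves C._≈_ ⟶ _≈_
  focus-cong = EqC.fold (On.isEquivalence focus V.isEquivalence) _∼_.focus-≈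

  ∈-fan⁻ : ∀ p {x} → Hypergraph._∈_ (ℍ 𝓗) x (fan p) →
           ∃₂ λ a (a∈U : a ∈ last p) → x C.≈ ⟨ p , a , a∈U ⟩
  ∈-fan⁻ p = mapWith∈⁻ V (last p) _

  fan-cong : ∀ {p q} → p ≋ q → fan p FC.≐ fan q
  fan-cong p≋q = half p≋q , half (≋-sym p≋q)
    where
    half : ∀ {p q} → p ≋ q → ∀ {x} → Hypergraph._∈_ (ℍ 𝓗) x (fan p) → Hypergraph._∈_ (ℍ 𝓗) x (fan q)
    half {p} {q} p≋q x∈ =
      let a , a∈p , x≈ = ∈-fan⁻ p x∈
          a∈q = proj₁ (last-cong p≋q) a∈p
      in ∈-resp-≈ classes (C.sym (C.trans x≈ (≋⇒≈ p≋q V.refl))) (∈-fan 𝓗 q a∈q)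

  map-focus-fan : ∀ p → map focus (fan p) ≐ last p
  map-focus-fan p =
      (λ a∈ → let x , x∈ , a≈x   = ∈-map⁻ classes V a∈
                  b , b∈U , x≈b = ∈-fan⁻ p x∈
              in ∈-resp-≈ V (V.sym (V.trans a≈x (focus-cong x≈b))) b∈U)
    , (λ a∈U → ∈-map⁺ classes V focus-cong (∈-fan 𝓗 p a∈U))

  ε : Morphism (ℍ 𝓗) 𝓗
  ε = record
    { func = record { to = focus ; cong = focus-cong }
    ; to-E = λ (p , xs≐fan) → E-resp
        (FiniteSubset.≐-sym V (FiniteSubset.≐-trans V
          (map-cong-≐ classes V focus-cong xs≐fan) (map-focus-fan p)))
        (proj₂ (lastEdge p))
    }

module _ {𝓗₁ 𝓗₂ : Hypergraph ℓ} where
  private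
    module 𝓗₁ = Hypergraph 𝓗₁
    module 𝓗₂ = Hypergraph 𝓗₂
    module P₁ = Plays 𝓗₁
    module P₂ = Plays 𝓗₂
    module V₂ = Setoid 𝓗₂.V
    module C₁ = Setoid P₁.classes
    module C₂ = Setoid P₂.classes
    module F₂ = FiniteSubset 𝓗₂.V
    module FC₂ = FiniteSubset P₂.classes
  open P₁ using ([_]; _▷_)
  open Membershipₚ using (∈-resp-≈; ∈-map⁺; ∈-map⁻)

  module _ (h : Morphism (ℍ 𝓗₁) 𝓗₂) where
    private module h = Morphism h
    open Coextension h

    imageEdge-cong : ∀ {p q} → p P₁.≋ q → proj₁ (imageEdge p) F₂.≐ proj₁ (imageEdge q)
    imageEdge-cong p≋q = map-cong-≐ P₁.classes 𝓗₂.V h.cong (fan-cong 𝓗₁ p≋q)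

    -- Each image hyperedge depends on the whole prefix up to it, so all of `d` goes to
    -- `imageEdge-cong`, not just its last entry.
    imagePlay-cong : ∀ {p q} → p P₁.≋ q → imagePlay p P₂.≋ imagePlay q
    imagePlay-cong d@([ _ ])   = P₂.[ imageEdge-cong d ]
    imagePlay-cong d@(p≋q ▷ _) = imagePlay-cong p≋q P₂.▷ imageEdge-cong d

    coextend : P₁.FocussedPlay → P₂.FocussedPlay
    coextend x = P₂.⟨ imagePlay (P₁.play x) , h.to x , image∈ (P₁.play x) (P₁.focus∈ x) ⟩

    coextend-cong : coextend Preserves C₁._≈_ ⟶ C₂._≈_
    coextend-cong = ≈-elim 𝓗₁ (On.isEquivalence coextend C₂.isEquivalence)
      (λ p≋q a≈b → ≋⇒≈ 𝓗₂ (imagePlay-cong p≋q) (h.cong (≋⇒≈ 𝓗₁ p≋q a≈b)))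
      (λ {p} {U} a∈p a∈U →
        let ha≈ha′ = h.cong (EqC.return (▷-∼ 𝓗₁ a∈p a∈U))
            -- `▷-∼` needs one vertex in both hyperedges; as `h` agrees on the two focussed plays,
            -- its value at the shorter one also lies in the new image hyperedge.
            ha∈VU  = ∈-resp-≈ 𝓗₂.V (V₂.sym ha≈ha′) (image∈ (p ▷ U) a∈U)
        in C₂.trans (EqC.return (▷-∼ 𝓗₂ (image∈ p a∈p) ha∈VU)) (≋⇒≈ 𝓗₂ P₂.≋-refl ha≈ha′))

    -- Every focus in the last hyperedge of `imagePlay p` is by construction a value of `h` on
    -- `fan p`. This yields both preservation of hyperedges and the composition law.
    map-coextend-fan : ∀ p → map coextend (P₁.fan p) FC₂.≐ P₂.fan (imagePlay p)
    map-coextend-fan p =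
        (λ y∈ → let x , x∈ , y≈ = ∈-map⁻ P₁.classes P₂.classes y∈
                    a , a∈U , x≈ = ∈-fan⁻ 𝓗₁ p x∈
                in ∈-resp-≈ P₂.classes (C₂.sym (C₂.trans y≈ (coextend-cong x≈)))
                     (∈-fan 𝓗₂ (imagePlay p) (image∈ p a∈U)))
      , (λ y∈ → let b , b∈V , y≈ = ∈-fan⁻ 𝓗₂ (imagePlay p) y∈
                    x , x∈ , b≈ = ∈-map⁻ P₁.classes 𝓗₂.V
                      -- `lastEdge (imagePlay p)` does not reduce for a variable `p`, hence the
                      -- transport.
                      (subst (λ U → b 𝓗₂.∈ proj₁ U) (last-imagePlay p) b∈V)
                    a , a∈U , x≈ = ∈-fan⁻ 𝓗₁ p x∈
                in ∈-resp-≈ P₂.classes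
                     (C₂.sym (C₂.trans y≈ (≋⇒≈ 𝓗₂ P₂.≋-refl (V₂.trans b≈ (h.cong x≈)))))
                     (∈-map⁺ P₁.classes P₂.classes coextend-cong (∈-fan 𝓗₁ p a∈U)))

    coextension : Morphism (ℍ 𝓗₁) (ℍ 𝓗₂)
    coextension = record
      { func = record { to = coextend ; cong = coextend-cong }
      ; to-E = λ (p , xs≐fan) → imagePlay p , FC₂.≐-trans
          (map-cong-≐ P₁.classes P₂.classes coextend-cong xs≐fan) (map-coextend-fan p)
      }

  imagePlay-≈ᴹ : ∀ {h k : Morphism (ℍ 𝓗₁) 𝓗₂} → h ≈ᴹ k → ∀ p →
                 Coextension.imagePlay h p P₂.≋ Coextension.imagePlay k p
  imagePlay-≈ᴹ h≈k p@([ _ ]) = P₂.[ map-≗-≐ 𝓗₂.V h≈k (P₁.fan p) ]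
  imagePlay-≈ᴹ h≈k p@(q ▷ _) = imagePlay-≈ᴹ h≈k q P₂.▷ map-≗-≐ 𝓗₂.V h≈k (P₁.fan p)

-- Each V_j is here the set of foci of the fan of the j-th prefix, which is U_j again.
imagePlay-ε : (𝓗 : Hypergraph ℓ) → ∀ p → Plays._≋_ 𝓗 (Coextension.imagePlay (ε 𝓗) p) p
imagePlay-ε 𝓗 p@(Plays.[ _ ]) = Plays.[ map-focus-fan 𝓗 p ]
imagePlay-ε 𝓗 p@(q Plays.▷ _) = imagePlay-ε 𝓗 q Plays.▷ map-focus-fan 𝓗 p

module _ {𝓗₁ 𝓗₂ 𝓗₃ : Hypergraph ℓ} (h : Morphism (ℍ 𝓗₁) 𝓗₂) (k : Morphism (ℍ 𝓗₂) 𝓗₃) where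
  private
    module P₁ = Plays 𝓗₁
    module P₂ = Plays 𝓗₂
    module P₃ = Plays 𝓗₃
    module h = Coextension h
    module k = Coextension k
    module kh = Coextension (k ∘ᴹ coextension h)
    module F₃ = FiniteSubset (Hypergraph.V 𝓗₃)

  -- The left side applies `k` to the coextended fan of `p`, the right side to the fan of
  -- `h.imagePlay p`; these two fans coincide.
  imageEdge-∘ : ∀ p → proj₁ (kh.imageEdge p) F₃.≐ proj₁ (k.imageEdge (h.imagePlay p))
  imageEdge-∘ p = map-∘-≐ P₂.classes (Hypergraph.V 𝓗₃) (Morphism.cong k) (map-coextend-fan h p)

  imagePlay-∘ : ∀ p → kh.imagePlay p P₃.≋ k.imagePlay (h.imagePlay p)
  imagePlay-∘ p@(P₁.[ _ ]) = P₃.[ imageEdge-∘ p ]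
  imagePlay-∘ p@(q P₁.▷ _) = imagePlay-∘ q P₃.▷ imageEdge-∘ p

-- In `counit-*` and `*-∘-*` the foci agree definitionally, which leaves the plays to compare;
-- `counit-∘-*` involves foci alone.
ℍ-comonad : KleisliComonad (HGraph ℓ) ℍ
ℍ-comonad = record
  { counit     = ε
  ; _*         = coextension
  ; *-cong     = λ {_} {B} h≈k x → ≋⇒≈ B (imagePlay-≈ᴹ h≈k (Plays.play x)) (h≈k x)
  ; counit-*   = λ {A} x → ≋⇒≈ A (imagePlay-ε A (Plays.play x)) (refl A)
  ; counit-∘-* = λ {_} {B} _ _ → refl B
  ; *-∘-*      = λ {_} {_} {D} h k x → ≋⇒≈ D (imagePlay-∘ h k (Plays.play x)) (refl D)
  }
  where
  refl : (𝓗 : Hypergraph ℓ) → ∀ {x} → Hypergraph._≈_ 𝓗 x x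
  refl 𝓗 = Setoid.refl (Hypergraph.V 𝓗)

theorem6p1 : ∀ {ℓ : Level} →
    Σ[ T ∈ KleisliComonad (HGraph ℓ) ℍ ]
    (∀ (𝓗 : Hypergraph ℓ) (p : Plays.Play 𝓗) (a : Hypergraph.Vertex 𝓗)
    (a∈U : Hypergraph._∈_ 𝓗 a (Plays.last 𝓗 p)) →
    Hypergraph._≈_ 𝓗
    (Morphism.to (KleisliComonad.counit T 𝓗) Plays.⟨ p , a , a∈U ⟩)
    a)
    ×
    (∀ {𝓗₁ 𝓗₂ : Hypergraph ℓ} (h : Morphism (ℍ 𝓗₁) 𝓗₂) (p : Plays.Play 𝓗₁)
    (a : Hypergraph.Vertex 𝓗₁) (a∈U : Hypergraph._∈_ 𝓗₁ a (Plays.last 𝓗₁ p)) →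
    Hypergraph._≈_ (ℍ 𝓗₂)
    (Morphism.to (KleisliComonad._* T h) Plays.⟨ p , a , a∈U ⟩)
    Plays.⟨ Coextension.imagePlay h p
    , Morphism.to h Plays.⟨ p , a , a∈U ⟩
    , Coextension.image∈ h p a∈U ⟩)
theorem6p1 =
    ℍ-comonad
  -- Counit and coextension are given on representatives by exactly these formulas, so reflexivity
  -- suffices.
  , (λ 𝓗 _ _ _ → Setoid.refl (Hypergraph.V 𝓗))
  , (λ {_} {𝓗₂} _ _ _ _ → Setoid.refl (Plays.classes 𝓗₂))
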